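{- Let $C_{(\geq,>)}(x,y)$ be the bivariate generating function of the Catalan words avoiding the ordered pair of relations $(\geq,>)$, where $x$ marks the length and $y$ marks the number of descents. Then $$C_{(\geq,>)}(x,y)=\frac{1 - 2 x + x^2 y - \sqrt{1 - 4 x + 4 x^2 - 2 x^2 y + x^4 y^2}}{2 x^2 y}.$$
   Context: A Catalan word of length $n$ is a word $w=w_1w_2\cdots w_n$ over the non-negative integers with $w_1=0$ and $0\leq w_i\leq w_{i-1}+1$ for $i=2,\dots,n$; the empty word is the unique Catalan word of length $0$. For relations $X,Y\in\{<,>,\leq,\geq,=,\neq\}$, a word $w$ contains the pattern $(X,Y)$ if there is an index $i\geq 1$ (with $i+2\le n$) such that $w_i\,X\,w_{i+1}$ and $w_{i+1}\,Y\,w_{i+2}$; otherwise $w$ avoids $(X,Y)$. The number of descents $\mathrm{des}(w)$ is the number of indices $i$ with $w_i>w_{i+1}$. The bivariate generating function is $C_{(X,Y)}(x,y)=\sum_{w}x^{|w|}y^{\mathrm{des}(w)}$, the sum being over all Catalan words $w$ (of any length $|w|\geq 0$) avoiding $(X,Y)$. Identities are between formal power series in $x$ with coefficients polynomials in $y$ (after clearing denominators); the square root of a power series with constant term $1$ is the one with constant term $1$. -}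

module Defs where

open import Data.Nat.Base as ℕ using (ℕ; zero; suc; _∸_; z≤n; s≤s)
import Data.Nat.Properties as ℕ
open import Data.Nat.Induction using (<-rec)
open import Data.Bool.Base using (if_then_else_)
open import Data.Integer.Base as ℤ using (ℤ; +_)
import Data.Integer.Properties as ℤ
open import Data.Integer.Tactic.RingSolver using (solve-∀)
open import Data.List.Base
  using (List; []; _∷_; map; foldr; concatMap; filter; upTo; applyUpTo; length)
open import Data.List.Properties using (∷-injectiveˡ; ∷-injectiveʳ)
open import Data.List.Membership.Propositional using (_∈_; find; lose)
open import Data.List.Membership.Propositional.Properties
  using (∈-map⁺; ∈-map⁻; ∈-concatMap⁺; ∈-concatMap⁻; ∈-upTo⁺; ∈-upTo⁻)
open import Data.List.Relation.Unary.Any using (here; there)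
import Data.List.Relation.Unary.All.Properties as All
import Data.List.Relation.Unary.All as All
import Data.List.Relation.Unary.AllPairs as AllPairs
import Data.List.Relation.Unary.AllPairs.Properties as AllPairs
open import Data.List.Relation.Unary.Linked using (Linked; []; [-]; _∷_)
open import Data.List.Relation.Unary.Unique.Propositional using (Unique)
import Data.List.Relation.Unary.Unique.Propositional.Properties as Unique
open import Data.Product.Base using (_×_; _,_)
open import Data.Sum.Base using (inj₁; inj₂; [_,_])
open import Function.Base using (_∘_)
open import Function.Bundles using (_⇔_; mk⇔)
open import Level using (0ℓ)
open import Relation.Binary.Core using (Rel)
open import Relation.Binary.Definitions using (Decidable)
open import Relation.Binary.PropositionalEquality
  using (_≡_; refl; sym; trans; cong; cong₂)
open import Relation.Nullary using (¬_; Dec; yes; no; does)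
open import Relation.Nullary.Decidable using (map′; ¬?; _×-dec_; _⊎-dec_)

------------------------------------------------------------------------
-- Catalan words

Word : Set
Word = List ℕ

Step : Rel ℕ 0ℓ
Step a b = b ℕ.≤ suc a

data IsCatalan : Word → Set where
  empty  : IsCatalan []
  from-0 : ∀ {w} → Linked Step (0 ∷ w) → IsCatalan (0 ∷ w)

data Contains (X Y : Rel ℕ 0ℓ) : Word → Set where
  here  : ∀ {a b c w} → X a b → Y b c → Contains X Y (a ∷ b ∷ c ∷ w)
  there : ∀ {a w} → Contains X Y w → Contains X Y (a ∷ w)

Avoids : (X Y : Rel ℕ 0ℓ) → Word → Set
Avoids X Y w = ¬ Contains X Y w

module _ {X Y : Rel ℕ 0ℓ} (X? : Decidable X) (Y? : Decidable Y) where

  contains? : (w : Word) → Dec (Contains X Y w)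
  contains? []              = no λ ()
  contains? (a ∷ [])        = no λ { (there ()) }
  contains? (a ∷ b ∷ [])    = no λ { (there (there ())) }
  contains? (a ∷ b ∷ c ∷ w) =
    map′ [ (λ (p , q) → here p q) , there ]
         (λ { (here p q) → inj₁ (p , q) ; (there p) → inj₂ p })
         ((X? a b ×-dec Y? b c) ⊎-dec contains? (b ∷ c ∷ w))

  avoids? : (w : Word) → Dec (Avoids X Y w)
  avoids? w = ¬? (contains? w)

des : Word → ℕ
des []          = 0
des (a ∷ [])    = 0
des (a ∷ b ∷ w) = (if does (b ℕ.<? a) then 1 else 0) ℕ.+ des (b ∷ w)

-- Words of length n with first letter at most k and all later letters
-- subject to Step.
wordsFrom : (k n : ℕ) → List Word
wordsFrom k zero    = [] ∷ []
wordsFrom k (suc n) =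
  concatMap (λ a → map (a ∷_) (wordsFrom (suc a) n)) (upTo (suc k))

catalanWords : ℕ → List Word
catalanWords n = wordsFrom 0 n

-- catalanWords n lists every Catalan word of length n exactly once:
-- see ∈-catalanWords and catalanWords-unique.

private
  withHead : ℕ → ℕ → List Word
  withHead n a = map (a ∷_) (wordsFrom (suc a) n)

∈-wordsFrom⁺ : ∀ {k} w → Linked Step (k ∷ w) → w ∈ wordsFrom (suc k) (length w)
∈-wordsFrom⁺ []      _       = here refl
∈-wordsFrom⁺ (a ∷ w) (s ∷ l) =
  ∈-concatMap⁺ (withHead (length w)) (lose (∈-upTo⁺ (s≤s s)) (∈-map⁺ (a ∷_) (∈-wordsFrom⁺ w l)))

∈-wordsFrom⁻ : ∀ {k} n {w} → w ∈ wordsFrom (suc k) n →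
               Linked Step (k ∷ w) × length w ≡ n
∈-wordsFrom⁻ zero    (here refl) = [-] , refl
∈-wordsFrom⁻ {k} (suc n) p
  with a , a∈ , q ← find (∈-concatMap⁻ (withHead n) {xs = upTo (suc (suc k))} p)
  with v , v∈ , refl ← ∈-map⁻ (a ∷_) q
  with l , eq ← ∈-wordsFrom⁻ n v∈
  = (ℕ.s≤s⁻¹ (∈-upTo⁻ a∈) ∷ l) , cong suc eq

∈-catalanWords : ∀ {n w} → w ∈ catalanWords n ⇔ (IsCatalan w × length w ≡ n)
∈-catalanWords {n} {w} = mk⇔ (to n) from
  where
  to : ∀ n {w} → w ∈ catalanWords n → IsCatalan w × length w ≡ n
  to zero    (here refl) = empty , refl
  to (suc n) p
    with a , a∈ , q ← find (∈-concatMap⁻ (withHead n) {xs = upTo 1} p)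
    with here refl ← a∈
    with v , v∈ , refl ← ∈-map⁻ (0 ∷_) q
    with l , eq ← ∈-wordsFrom⁻ n v∈
    = from-0 l , cong suc eq

  from : ∀ {n w} → IsCatalan w × length w ≡ n → w ∈ catalanWords n
  from (empty , refl)        = here refl
  from (from-0 {w} l , refl) =
    ∈-concatMap⁺ (withHead (length w)) (lose (∈-upTo⁺ {n = 1} (s≤s z≤n)) (∈-map⁺ (0 ∷_) (∈-wordsFrom⁺ w l)))

wordsFrom-unique : ∀ k n → Unique (wordsFrom k n)
wordsFrom-unique k zero    = All.[] AllPairs.∷ AllPairs.[]
wordsFrom-unique k (suc n) =
  Unique.concat⁺
    (All.map⁺ (All.tabulate λ {a} _ →
      Unique.map⁺ ∷-injectiveʳ (wordsFrom-unique (suc a) n)))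
    (AllPairs.map⁺ (AllPairs.map disjoint (Unique.upTo⁺ (suc k))))
  where
  disjoint : ∀ {a b} → ¬ a ≡ b → ∀ {w} →
             ¬ (w ∈ map (a ∷_) (wordsFrom (suc a) n) ×
                w ∈ map (b ∷_) (wordsFrom (suc b) n))
  disjoint a≢b (p , q)
    with _ , _ , e₁ ← ∈-map⁻ _ p
    with _ , _ , e₂ ← ∈-map⁻ _ q
    = a≢b (∷-injectiveˡ (trans (sym e₁) e₂))

catalanWords-unique : ∀ n → Unique (catalanWords n)
catalanWords-unique = wordsFrom-unique 0

------------------------------------------------------------------------
-- Polynomials in y over ℤ: lists of coefficients, constant term first.
-- Trailing zeros are allowed, so equality is _≈_ and not _≡_.

module Poly where

  Poly : Set
  Poly = List ℤ

  coeff : Poly → ℕ → ℤ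
  coeff []      _       = + 0
  coeff (a ∷ p) zero    = a
  coeff (a ∷ p) (suc k) = coeff p k

  infix 4 _≈_
  _≈_ : Rel Poly 0ℓ
  p ≈ q = ∀ k → coeff p k ≡ coeff q k

  infixl 6 _+_
  infixl 7 _*_

  _+_ : Poly → Poly → Poly
  []      + q       = q
  (a ∷ p) + []      = a ∷ p
  (a ∷ p) + (b ∷ q) = (a ℤ.+ b) ∷ (p + q)

  -_ : Poly → Poly
  - p = map ℤ.-_ p

  _*_ : Poly → Poly → Poly
  []      * q = []
  (a ∷ p) * q = map (a ℤ.*_) q + (+ 0 ∷ p * q)

  const : ℤ → Poly
  const a = a ∷ []

  y^_ : ℕ → Poly
  y^ zero  = const (+ 1)
  y^ suc n = + 0 ∷ y^ n

  sum : List Poly → Poly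
  sum = foldr _+_ []

open Poly using (Poly)

------------------------------------------------------------------------
-- Formal power series in x over ℤ[y]: f n is the coefficient of xⁿ.

Series : Set
Series = ℕ → Poly

infix  4 _≈_
infixl 6 _+_ _-_
infixl 7 _*_
infixr 8 _^_
infix  9 #_

_≈_ : Rel Series 0ℓ
f ≈ g = ∀ n → f n Poly.≈ g n

_+_ : Series → Series → Series
(f + g) n = f n Poly.+ g n

_-_ : Series → Series → Series
(f - g) n = f n Poly.+ (Poly.- g n)

_*_ : Series → Series → Series
(f * g) n = Poly.sum (applyUpTo (λ i → f i Poly.* g (n ∸ i)) (suc n))

const : Poly → Series
const p zero    = p
const p (suc _) = []

#_ : ℕ → Series
# m = const (Poly.const (+ m))

_^_ : Series → ℕ → Series
f ^ zero  = # 1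
f ^ suc n = f * f ^ n

x : Series
x 1 = Poly.const (+ 1)
x _ = []

y : Series
y = const (Poly.y^ 1)

-- g is the square root of f with constant term 1; at most one such g
-- exists, see sqrt-unique.
IsSqrt : Series → Series → Set
IsSqrt f g = (g 0 Poly.≈ Poly.const (+ 1)) × (g * g ≈ f)

------------------------------------------------------------------------
-- The generating function Σ x^|w| y^des(w) over the Catalan words w
-- avoiding (X, Y)

C : {X Y : Rel ℕ 0ℓ} → Decidable X → Decidable Y → Series
C X? Y? n =
  Poly.sum (map (λ w → Poly.y^ des w) (filter (avoids? X? Y?) (catalanWords n)))

------------------------------------------------------------------------
-- Uniqueness of square roots with constant term 1

module Coefficients where
  -- Multiplication on coefficient sequences.
  conv : (ℕ → ℤ) → (ℕ → ℤ) → ℕ → ℤ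
  conv f g zero    = f 0 ℤ.* g 0
  conv f g (suc k) = f 0 ℤ.* g (suc k) ℤ.+ conv (f ∘ suc) g k

  conv-cong : ∀ {f f′ g g′ : ℕ → ℤ} → (∀ k → f k ≡ f′ k) → (∀ k → g k ≡ g′ k) →
              ∀ k → conv f g k ≡ conv f′ g′ k
  conv-cong p q zero    = cong₂ ℤ._*_ (p 0) (q 0)
  conv-cong p q (suc k) =
    cong₂ ℤ._+_ (cong₂ ℤ._*_ (p 0) (q (suc k))) (conv-cong (p ∘ suc) q k)

  conv-zeroˡ : ∀ g k → conv (λ _ → + 0) g k ≡ + 0
  conv-zeroˡ g zero    = refl
  conv-zeroˡ g (suc k) = trans (ℤ.+-identityˡ _) (conv-zeroˡ g k)

  coeff-+ : ∀ p q k → Poly.coeff (p Poly.+ q) k ≡ Poly.coeff p k ℤ.+ Poly.coeff q k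
  coeff-+ []      q       k       = sym (ℤ.+-identityˡ _)
  coeff-+ (a ∷ p) []      k       = sym (ℤ.+-identityʳ _)
  coeff-+ (a ∷ p) (b ∷ q) zero    = refl
  coeff-+ (a ∷ p) (b ∷ q) (suc k) = coeff-+ p q k

  coeff-scale : ∀ a p k → Poly.coeff (map (a ℤ.*_) p) k ≡ a ℤ.* Poly.coeff p k
  coeff-scale a []      k       = sym (ℤ.*-zeroʳ a)
  coeff-scale a (b ∷ p) zero    = refl
  coeff-scale a (b ∷ p) (suc k) = coeff-scale a p k

  coeff-* : ∀ p q k → Poly.coeff (p Poly.* q) k ≡ conv (Poly.coeff p) (Poly.coeff q) k
  coeff-* []      q k       = sym (conv-zeroˡ (Poly.coeff q) k)
  coeff-* (a ∷ p) q zero    =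
    trans (coeff-+ (map (a ℤ.*_) q) _ 0)
          (trans (ℤ.+-identityʳ _) (coeff-scale a q 0))
  coeff-* (a ∷ p) q (suc k) =
    trans (coeff-+ (map (a ℤ.*_) q) _ (suc k))
          (cong₂ ℤ._+_ (coeff-scale a q (suc k)) (coeff-* p q k))

  *-cong : ∀ p p′ q q′ → p Poly.≈ p′ → q Poly.≈ q′ → p Poly.* q Poly.≈ p′ Poly.* q′
  *-cong p p′ q q′ e e′ k =
    trans (coeff-* p q k) (trans (conv-cong e e′ k) (sym (coeff-* p′ q′ k)))

  one : Poly
  one = Poly.const (+ 1)

  *-identityˡ : ∀ p → one Poly.* p Poly.≈ p
  *-identityˡ p zero    = trans (coeff-* one p 0) (ℤ.*-identityˡ _)
  *-identityˡ p (suc k) =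
    trans (coeff-* one p (suc k))
          (trans (cong₂ ℤ._+_ (ℤ.*-identityˡ (Poly.coeff p (suc k))) (conv-zeroˡ (Poly.coeff p) k)) (ℤ.+-identityʳ _))

  conv-identityʳ : ∀ f k → conv f (Poly.coeff one) k ≡ f k
  conv-identityʳ f zero    = ℤ.*-identityʳ _
  conv-identityʳ f (suc k) =
    trans (cong₂ ℤ._+_ (ℤ.*-zeroʳ (f 0)) (conv-identityʳ (f ∘ suc) k)) (ℤ.+-identityˡ _)

  *-identityʳ : ∀ p → p Poly.* one Poly.≈ p
  *-identityʳ p k = trans (coeff-* p one k) (conv-identityʳ (Poly.coeff p) k)

  ∑ : (ℕ → Poly) → ℕ → Poly
  ∑ F n = Poly.sum (applyUpTo F n)

  ∑-cong : ∀ F G n → (∀ {i} → i ℕ.< n → F i Poly.≈ G i) → ∑ F n Poly.≈ ∑ G n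
  ∑-cong F G zero    e k = refl
  ∑-cong F G (suc n) e k =
    trans (coeff-+ (F 0) (∑ (F ∘ suc) n) k)
          (trans (cong₂ ℤ._+_ (e (s≤s z≤n) k)
                              (∑-cong (F ∘ suc) (G ∘ suc) n (λ i<n → e (s≤s i<n)) k))
                 (sym (coeff-+ (G 0) (∑ (G ∘ suc) n) k)))

  ∑-last : ∀ F n k → Poly.coeff (∑ F (suc n)) k ≡
                     Poly.coeff (∑ F n) k ℤ.+ Poly.coeff (F n) k
  ∑-last F zero    k = trans (coeff-+ (F 0) [] k) (ℤ.+-comm (Poly.coeff (F 0) k) (+ 0))
  ∑-last F (suc n) k =
    trans (coeff-+ (F 0) (∑ (F ∘ suc) (suc n)) k)
    (trans (cong (λ z → Poly.coeff (F 0) k ℤ.+ z) (∑-last (F ∘ suc) n k))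
    (trans (sym (ℤ.+-assoc (Poly.coeff (F 0) k) _ _))
           (cong (λ z → z ℤ.+ Poly.coeff (F (suc n)) k) (sym (coeff-+ (F 0) (∑ (F ∘ suc) n) k)))))

  -- The terms of (g * g) (suc m) involving neither g 0 nor g (suc m).
  inner : Series → ℕ → Poly
  inner g m = ∑ (λ i → g (suc i) Poly.* g (m ∸ i)) m

  square-coeff : ∀ g m → g 0 Poly.≈ one → ∀ k →
    Poly.coeff ((g * g) (suc m)) k ≡
    Poly.coeff (g (suc m)) k ℤ.+
      (Poly.coeff (inner g m) k ℤ.+ Poly.coeff (g (suc m)) k)
  square-coeff g m g₀ k =
    trans (coeff-+ (g 0 Poly.* g (suc m)) (∑ (λ i → g (suc i) Poly.* g (m ∸ i)) (suc m)) k)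
    (cong₂ ℤ._+_
      (trans (*-cong (g 0) one (g (suc m)) (g (suc m)) g₀ (λ _ → refl) k) (*-identityˡ (g (suc m)) k))
      (trans (∑-last (λ i → g (suc i) Poly.* g (m ∸ i)) m k)
        (cong (λ z → Poly.coeff (inner g m) k ℤ.+ z)
          (trans (*-cong (g (suc m)) (g (suc m)) (g (m ∸ m)) one (λ _ → refl) last₀ k)
                 (*-identityʳ (g (suc m)) k)))))
    where
    last₀ : g (m ∸ m) Poly.≈ one
    last₀ rewrite ℕ.n∸n≡0 m = g₀

  cancel : ∀ {a b c d} → c ≡ d → a ℤ.+ (c ℤ.+ a) ≡ b ℤ.+ (d ℤ.+ b) → a ≡ b
  cancel {a} {b} {c} refl e = ℤ.*-cancelˡ-≡ (+ 2) a b
    (trans (shuffle a c) (trans (cong (ℤ._- c) e) (sym (shuffle b c))))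
    where
    shuffle : ∀ a c → + 2 ℤ.* a ≡ (a ℤ.+ (c ℤ.+ a)) ℤ.- c
    shuffle = solve-∀

open Coefficients

sqrt-unique : ∀ {f g h} → IsSqrt f g → IsSqrt f h → g ≈ h
sqrt-unique {f} {g} {h} (g₀ , g²) (h₀ , h²) =
  <-rec (λ n → g n Poly.≈ h n) step
  where
  step : ∀ n → (∀ {i} → i ℕ.< n → g i Poly.≈ h i) → g n Poly.≈ h n
  step zero    _  k = trans (g₀ k) (sym (h₀ k))
  step (suc m) ih k = cancel
    (∑-cong (λ i → g (suc i) Poly.* g (m ∸ i)) (λ i → h (suc i) Poly.* h (m ∸ i)) m
      (λ {i} i<m → *-cong (g (suc i)) (h (suc i)) (g (m ∸ i)) (h (m ∸ i))
                     (ih (s≤s i<m)) (ih (s≤s (ℕ.m∸n≤m m i)))) k)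
    (trans (sym (square-coeff g m g₀ k))
      (trans (trans (g² (suc m) k) (sym (h² (suc m) k))) (square-coeff h m h₀ k)))

{-# OPTIONS --safe #-}
module Submission where

-- After a letter a that did not exceed its predecessor, the next letter
-- is a or a + 1; after an ascent to a it can also be any b < a.  Let L a
-- be the series of the continuations in the first case and y x Σ_{b<a} L b
-- (called D a) the extra contribution in the second.  Then
-- L a = 1 + x (L a + L (a + 1) + D (a + 1)), and this infinite system is
-- solved by L a = L 0 (1 + x D a): the differences M a satisfy a linear
-- system M = x (…) M, so every power of x divides them.  For a = 1 this
-- closes the equation for L 0, and C = 1 + x L 0 becomes a root of
-- x² y C² - (1 - 2 x + x² y) C + 1 - x, whose discriminant is the
-- radicand; hence 1 - 2 x + x² y - 2 x² y C is its square root.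

open import Algebra.Bundles using (AbelianGroup; CommutativeMonoid; CommutativeRing; RawRing)
import Algebra.Consequences.Setoid as Consequences
import Algebra.Construct.Pointwise as Pointwise
import Algebra.Morphism.RingMonomorphism as RingMonomorphism
open import Algebra.Morphism.Structures using (IsRingMonomorphism)
import Algebra.Properties.CommutativeSemigroup as CommutativeSemigroup
import Algebra.Properties.Ring as RingProperties
import Algebra.Properties.Semiring.Divisibility as Divisibility
import Algebra.Properties.Semiring.Exp as Exp
import Algebra.Solver.Ring as RingSolver
open import Algebra.Solver.Ring.AlmostCommutativeRing
  using (_-Raw-AlmostCommutative⟶_; fromCommutativeRing)
open import Data.Bool.Base using (true; false; not; if_then_else_)
open import Data.Integer.Base as ℤ using (ℤ; +_)
import Data.Integer.Properties as ℤ
open import Data.List.Base using (List; []; _∷_; _++_; map; concatMap; filter; upTo)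
open import Data.List.Properties using (map-∘; map-upTo; map-cong; map-++)
open import Data.Maybe.Base as Maybe using (Maybe)
open import Data.Nat.Base as ℕ using (ℕ; zero; suc)
open import Data.Nat.Properties as ℕ using (_≥?_; _>?_; _≤?_; _<?_)
open import Data.Product using (∃-syntax; _×_; _,_)
open import Function.Base using (_∘_; id)
open import Level using (Level; 0ℓ)
import Relation.Binary.Reasoning.Setoid as SetoidReasoning
import Relation.Binary.PropositionalEquality as ≡
open import Relation.Nullary.Decidable using (does; dec-true; dec-false; dec⇒maybe)
open import Relation.Unary using (Pred; Decidable)

-- The ring of formal power series over a commutative ring

module PowerSeries {c ℓ : Level} (R : CommutativeRing c ℓ) where
  open CommutativeRing R
  open SetoidReasoning setoid
  open CommutativeSemigroup (CommutativeMonoid.commutativeSemigroup +-commutativeMonoid)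
    using (interchange; x∙yz≈y∙xz)

  infix  4 _≋_
  infixl 7 _⊛_

  _≋_ : (f g : ℕ → Carrier) → Set ℓ
  f ≋ g = ∀ n → f n ≈ g n

  -- The Cauchy product, peeling off the constant term of the left factor: the ring laws then go by
  -- structural induction on the degree, without finite sums or truncated subtraction.
  _⊛_ : (f g : ℕ → Carrier) → ℕ → Carrier
  (f ⊛ g) zero    = f 0 * g 0
  (f ⊛ g) (suc n) = f 0 * g (suc n) + ((f ∘ suc) ⊛ g) n

  constant : Carrier → ℕ → Carrier
  constant a zero    = a
  constant a (suc _) = 0#

  ⊛-cong : ∀ {f f′ g g′} → f ≋ f′ → g ≋ g′ → f ⊛ g ≋ f′ ⊛ g′
  ⊛-cong p q zero    = *-cong (p 0) (q 0)
  ⊛-cong p q (suc n) = +-cong (*-cong (p 0) (q (suc n))) (⊛-cong (p ∘ suc) q n)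

  ⊛-distribʳ : ∀ h f g → (λ n → f n + g n) ⊛ h ≋ λ n → (f ⊛ h) n + (g ⊛ h) n
  ⊛-distribʳ h f g zero    = distribʳ _ _ _
  ⊛-distribʳ h f g (suc n) =
    trans (+-cong (distribʳ _ _ _) (⊛-distribʳ h (f ∘ suc) (g ∘ suc) n))
          (interchange _ _ _ _)

  ⊛-scaleˡ : ∀ a f g → (λ n → a * f n) ⊛ g ≋ λ n → a * (f ⊛ g) n
  ⊛-scaleˡ a f g zero    = *-assoc _ _ _
  ⊛-scaleˡ a f g (suc n) =
    trans (+-cong (*-assoc _ _ _) (⊛-scaleˡ a (f ∘ suc) g n)) (sym (distribˡ _ _ _))

  ⊛-assoc : ∀ f g h → (f ⊛ g) ⊛ h ≋ f ⊛ (g ⊛ h)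
  ⊛-assoc f g h zero    = *-assoc _ _ _
  ⊛-assoc f g h (suc n) = begin
    f 0 * g 0 * h (suc n) + (((f ⊛ g) ∘ suc) ⊛ h) n
      ≈⟨ +-congˡ (⊛-distribʳ h (λ k → f 0 * g (suc k)) ((f ∘ suc) ⊛ g) n) ⟩
    f 0 * g 0 * h (suc n) + (((λ k → f 0 * g (suc k)) ⊛ h) n + (((f ∘ suc) ⊛ g) ⊛ h) n)
      ≈⟨ +-cong (*-assoc _ _ _)
                (+-cong (⊛-scaleˡ (f 0) (g ∘ suc) h n) (⊛-assoc (f ∘ suc) g h n)) ⟩
    f 0 * (g 0 * h (suc n)) + (f 0 * ((g ∘ suc) ⊛ h) n + ((f ∘ suc) ⊛ (g ⊛ h)) n)
      ≈⟨ +-assoc _ _ _ ⟨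
    f 0 * (g 0 * h (suc n)) + f 0 * ((g ∘ suc) ⊛ h) n + ((f ∘ suc) ⊛ (g ⊛ h)) n
      ≈⟨ +-congʳ (distribˡ _ _ _) ⟨
    f 0 * (g ⊛ h) (suc n) + ((f ∘ suc) ⊛ (g ⊛ h)) n ∎

  -- The mirror image of the defining clause. Since `_⊛_` treats its factors asymmetrically, this is
  -- what makes the induction for `⊛-comm` close.
  ⊛-tailʳ : ∀ f g n → (f ⊛ g) (suc n) ≈ f (suc n) * g 0 + (f ⊛ (g ∘ suc)) n
  ⊛-tailʳ f g zero    = +-comm _ _
  ⊛-tailʳ f g (suc n) =
    trans (+-congˡ (⊛-tailʳ (f ∘ suc) g n)) (x∙yz≈y∙xz _ _ _)

  ⊛-comm : ∀ f g → f ⊛ g ≋ g ⊛ f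
  ⊛-comm f g zero    = *-comm _ _
  ⊛-comm f g (suc n) =
    trans (+-cong (*-comm _ _) (⊛-comm (f ∘ suc) g n)) (sym (⊛-tailʳ g f n))

  ⊛-zeroˡ : ∀ f → (λ _ → 0#) ⊛ f ≋ λ _ → 0#
  ⊛-zeroˡ f zero    = zeroˡ _
  ⊛-zeroˡ f (suc n) = trans (+-cong (zeroˡ _) (⊛-zeroˡ f n)) (+-identityˡ _)

  constant-⊛ : ∀ a f → constant a ⊛ f ≋ λ n → a * f n
  constant-⊛ a f zero    = refl
  constant-⊛ a f (suc n) = trans (+-congˡ (⊛-zeroˡ f n)) (+-identityʳ _)

  commutativeRing : CommutativeRing c ℓ
  commutativeRing = record
    { Carrier = ℕ → Carrier
    ; _≈_     = _≋_
    ; _+_     = λ f g n → f n + g n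
    ; _*_     = _⊛_
    ; -_      = λ f n → - f n
    ; 0#      = λ _ → 0#
    ; 1#      = constant 1#
    ; isCommutativeRing = record
      { isRing = record
        { +-isAbelianGroup = Pointwise.isAbelianGroup ℕ +-isAbelianGroup
        ; *-cong           = ⊛-cong
        ; *-assoc          = ⊛-assoc
        ; *-identity       = comm∧idˡ⇒id ⊛-comm λ f n →
            trans (constant-⊛ 1# f n) (*-identityˡ _)
        ; distrib          =
            comm∧distrʳ⇒distr (λ p q n → +-cong (p n) (q n)) ⊛-comm ⊛-distribʳ
        }
      ; *-comm = ⊛-comm
      }
    }
    where
    open Consequences (AbelianGroup.setoid (Pointwise.abelianGroup ℕ +-abelianGroup))

-- Solving the system for `L` in an abstract ring

-- The algebra is done over an abstract ring because over Series the
-- equality unfolds to coefficients and unification no longer finds the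
-- implicit arguments of the ring solver.
module TransferSystem {c ℓ : Level} (R : CommutativeRing c ℓ)
  (integers : CommutativeRing.rawRing ℤ.+-*-commutativeRing -Raw-AlmostCommutative⟶ fromCommutativeRing R)
  where
  open CommutativeRing R
  open _-Raw-AlmostCommutative⟶_ integers using (⟦_⟧)

  _≟_ : ∀ a b → Maybe (⟦ a ⟧ ≈ ⟦ b ⟧)
  a ≟ b = Maybe.map (λ { ≡.refl → refl }) (dec⇒maybe (a ℤ.≟ b))

  open RingSolver (CommutativeRing.rawRing ℤ.+-*-commutativeRing) (fromCommutativeRing R) integers _≟_
    hiding (⟦_⟧)
  open RingProperties ring using (x∙y⁻¹≈ε⇒x≈y)
  open Divisibility semiring using (_∣_; _,_; 1∣_)
  open Exp semiring using (_^_)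
  open SetoidReasoning setoid

  infix 9 #_
  #_ : ℕ → Carrier
  # n = ⟦ + n ⟧

  quadratic : (x y c : Carrier) → Carrier
  quadratic x y c = # 1 - x + x ^ 2 * y * c * c - (# 1 - # 2 * x + x ^ 2 * y) * c

  -- Completing the square: if q = e - b c + a c², then (b - 2 a c)² = b² - 4 a e + 4 a q. Here a =
  -- x² y, b = 1 - 2 x + x² y and e = 1 - x.
  quadratic-discriminant : ∀ x y c → quadratic x y c ≈ 0# →
    let s = # 1 - # 2 * x + x ^ 2 * y - # 2 * x ^ 2 * y * c in
    s * s ≈ # 1 - # 4 * x + # 4 * x ^ 2 - # 2 * x ^ 2 * y + x ^ 4 * y ^ 2
  quadratic-discriminant x y c q≈0 = begin
    _ ≈⟨ solve 3 (λ x y c →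
           let s = con (+ 1) :- con (+ 2) :* x :+ x :^ 2 :* y :- con (+ 2) :* x :^ 2 :* y :* c
               q = con (+ 1) :- x :+ x :^ 2 :* y :* c :* c
                     :- (con (+ 1) :- con (+ 2) :* x :+ x :^ 2 :* y) :* c
           in s :* s := con (+ 1) :- con (+ 4) :* x :+ con (+ 4) :* x :^ 2
                          :- con (+ 2) :* x :^ 2 :* y :+ x :^ 4 :* y :^ 2
                          :+ con (+ 4) :* x :^ 2 :* y :* q)
           refl x y c ⟩
    _ ≈⟨ +-congˡ (trans (*-congˡ q≈0) (zeroʳ _)) ⟩
    _ ≈⟨ +-identityʳ _ ⟩
    _ ∎

  subtrahend-recovery : ∀ a b → b ≈ a - (a - b)
  subtrahend-recovery = solve 2 (λ a b → b := a :- (a :- b)) refl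

  -- `separated` says that the x-adic topology is Hausdorff; it replaces any reference to
  -- coefficients.
  module _
    (x y : Carrier)
    (separated : ∀ f → (∀ n → x ^ n ∣ f) → f ≈ 0#)
    (L D : ℕ → Carrier)
    (D-zero : D 0 ≈ 0#)
    (D-suc  : ∀ a → D (suc a) ≈ D a + y * (x * L a))
    (L-step : ∀ a → L a ≈ # 1 + x * (L a + (L (suc a) + D (suc a))))
    where

    K M : ℕ → Carrier
    K a = # 1 + x * D a
    M a = L a - L 0 * K a

    -- Subtract `K a` times the equation for `L 0` from the equation for `L a`. The constants leave
    -- 1 - `K a` = - x `D a`, so a factor x comes out. The term `M 1` stems from the `L 1` in the
    -- equation for `L 0`.
    M-step : ∀ a → M a ≈ x * ((# 1 + (# 1 + x * L 0) * (x * y)) * M a + M (suc a) + - K a * M 1)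
    M-step a = begin
      L a - L 0 * K a
        -- First `D (suc a)` and `D 1` are expressed through `D a` and the values of `L`; what
        -- remains is a polynomial identity in independent variables.
        ≈⟨ +-cong (L-step′ a) (-‿cong (*-congʳ (L-step′ 0))) ⟩
      # 1 + x * (L a + (L (suc a) + (D a + y * (x * L a))))
        - (# 1 + x * (L 0 + (L 1 + (D 0 + y * (x * L 0))))) * K a
        ≈⟨ +-congˡ (-‿cong (*-congʳ (+-congˡ (*-congˡ (+-congˡ (+-congˡ D1≈)))))) ⟩
      # 1 + x * (L a + (L (suc a) + (D a + y * (x * L a))))
        - (# 1 + x * (L 0 + (L 1 + y * (x * L 0)))) * K a
        ≈⟨ solve 7 (λ x y l0 l1 la l′ d →
             let k  = con (+ 1) :+ x :* d
                 d′ = d :+ y :* (x :* la)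
                 d1 = y :* (x :* l0)
                 m  = la :- l0 :* k
                 m′ = l′ :- l0 :* (con (+ 1) :+ x :* d′)
                 m1 = l1 :- l0 :* (con (+ 1) :+ x :* d1)
             in con (+ 1) :+ x :* (la :+ (l′ :+ d′)) :- (con (+ 1) :+ x :* (l0 :+ (l1 :+ d1))) :* k
                := x :* ((con (+ 1) :+ (con (+ 1) :+ x :* l0) :* (x :* y)) :* m :+ m′ :+ :- k :* m1))
             refl x y (L 0) (L 1) (L a) (L (suc a)) (D a) ⟩
      x * ((# 1 + (# 1 + x * L 0) * (x * y)) * M a
        + (L (suc a) - L 0 * (# 1 + x * (D a + y * (x * L a))))
        + - K a * (L 1 - L 0 * (# 1 + x * (y * (x * L 0)))))
        ≈⟨ *-congˡ (+-cong (+-congˡ (M-cong (D-suc a))) (*-congˡ (M-cong (trans (D-suc 0) D1≈)))) ⟨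
      x * ((# 1 + (# 1 + x * L 0) * (x * y)) * M a + M (suc a) + - K a * M 1) ∎
      where
      L-step′ : ∀ a → L a ≈ # 1 + x * (L a + (L (suc a) + (D a + y * (x * L a))))
      L-step′ a = trans (L-step a) (+-congˡ (*-congˡ (+-congˡ (+-congˡ (D-suc a)))))

      D1≈ : D 0 + y * (x * L 0) ≈ y * (x * L 0)
      D1≈ = trans (+-congʳ D-zero) (+-identityˡ _)

      M-cong : ∀ {l d d′} → d ≈ d′ → l - L 0 * (# 1 + x * d) ≈ l - L 0 * (# 1 + x * d′)
      M-cong e = +-congˡ (-‿cong (*-congˡ (+-congˡ (*-congˡ e))))

    -- Induction on n for all a at once, since `M-step` for a refers to `suc a` and 1. Its
    -- right-hand side is linear in `M`, so the quotients combine, and the outer x supplies one more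
    -- factor.
    x^n∣M : ∀ n a → x ^ n ∣ M a
    x^n∣M zero    a = 1∣ M a
    x^n∣M (suc n) a with x^n∣M n a | x^n∣M n (suc a) | x^n∣M n 1
    ... | p , p≈ | q , q≈ | r , r≈ = u * p + q + - K a * r , (begin
      (u * p + q + - K a * r) * (x * x ^ n)
        ≈⟨ solve 7 (λ u p q k r x z →
             (u :* p :+ q :+ k :* r) :* (x :* z) := x :* (u :* (p :* z) :+ q :* z :+ k :* (r :* z)))
             refl u p q (- K a) r x (x ^ n) ⟩
      x * (u * (p * x ^ n) + q * x ^ n + - K a * (r * x ^ n))
        ≈⟨ *-congˡ (+-cong (+-cong (*-congˡ p≈) q≈) (*-congˡ r≈)) ⟩
      x * (u * M a + M (suc a) + - K a * M 1)
        ≈⟨ M-step a ⟨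
      M a ∎)
      where u = # 1 + (# 1 + x * L 0) * (x * y)

    L≈L₀K : ∀ a → L a ≈ L 0 * K a
    L≈L₀K a = x∙y⁻¹≈ε⇒x≈y _ _ (separated (M a) (λ n → x^n∣M n a))

    -- At c = 1 + x `L 0` the quadratic is x times the difference of the two sides of `L-step 0`,
    -- once `L 1` is replaced by `L 0 * K 1` and `D 1` by y x `L 0`.
    quadratic-root : ∀ {c} → c ≈ # 1 + x * L 0 → quadratic x y c ≈ 0#
    quadratic-root {c} c≈ = begin
      quadratic x y c
        ≈⟨ +-cong (+-congˡ (*-cong (*-congˡ c≈) c≈)) (-‿cong (*-congˡ c≈)) ⟩
      quadratic x y (# 1 + x * L 0)
        ≈⟨ solve 3 (λ x y l →
             let c = con (+ 1) :+ x :* l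
                 d = y :* (x :* l) in
             con (+ 1) :- x :+ x :^ 2 :* y :* c :* c :- (con (+ 1) :- con (+ 2) :* x :+ x :^ 2 :* y) :* c
             := x :* ((con (+ 1) :+ x :* (l :+ (l :* (con (+ 1) :+ x :* d) :+ d))) :- l))
             refl x y (L 0) ⟩
      x * ((# 1 + x * (L 0 + (L 0 * (# 1 + x * d) + d))) - L 0)
        ≈⟨ *-congˡ (+-congʳ (+-congˡ (*-congˡ (+-congˡ (+-cong (*-congˡ (+-congˡ (*-congˡ d≈))) d≈))))) ⟩
      x * ((# 1 + x * (L 0 + (L 0 * K 1 + D 1))) - L 0)
        ≈⟨ *-congˡ (+-congʳ (trans (+-congˡ (*-congˡ (+-congˡ (+-congʳ (sym (L≈L₀K 1)))))) (sym (L-step 0)))) ⟩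
      x * (L 0 - L 0)
        ≈⟨ *-congˡ (-‿inverseʳ (L 0)) ⟩
      x * 0#
        ≈⟨ zeroʳ x ⟩
      0# ∎
      where
      d = y * (x * L 0)
      d≈ : d ≈ D 1
      d≈ = sym (trans (D-suc 0) (trans (+-congʳ D-zero) (+-identityˡ _)))

-- Polynomials and series as commutative rings

open import Defs
open ≡ using (_≡_; _≗_; refl; sym; trans; cong; cong₂; module ≡-Reasoning)
open Coefficients using (∑; ∑-cong; ∑-last; coeff-+)
open Poly using (Poly)

module ℤ[[y]] = PowerSeries ℤ.+-*-commutativeRing

coeff-neg : ∀ p k → Poly.coeff (Poly.- p) k ≡ ℤ.- Poly.coeff p k
coeff-neg []      k       = refl
coeff-neg (a ∷ p) zero    = refl
coeff-neg (a ∷ p) (suc k) = coeff-neg p k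

conv≗⊛ : ∀ f g k → Coefficients.conv f g k ≡ (f ℤ[[y]].⊛ g) k
conv≗⊛ f g zero    = refl
conv≗⊛ f g (suc k) = cong (λ z → f 0 ℤ.* g (suc k) ℤ.+ z) (conv≗⊛ (f ∘ suc) g k)

polyRawRing : RawRing 0ℓ 0ℓ
polyRawRing = record
  { Carrier = Poly
  ; _≈_ = Poly._≈_ ; _+_ = Poly._+_ ; _*_ = Poly._*_ ; -_ = Poly.-_
  ; 0# = [] ; 1# = Poly.const (+ 1)
  }

-- Equality of polynomials is by definition equality of coefficient sequences, so `coeff` is
-- injective trivially and the ring laws of ℤ[[y]] pull back to `Poly`.
coeff-isRingMonomorphism :
  IsRingMonomorphism polyRawRing (CommutativeRing.rawRing ℤ[[y]].commutativeRing) Poly.coeff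
coeff-isRingMonomorphism = record
  { isRingHomomorphism = record
    { isSemiringHomomorphism = record
      { isNearSemiringHomomorphism = record
        { +-isMonoidHomomorphism = record
          { isMagmaHomomorphism = record
            { isRelHomomorphism = record { cong = id }
            ; homo = Coefficients.coeff-+
            }
          ; ε-homo = λ _ → refl
          }
        ; *-homo = λ p q k → trans (Coefficients.coeff-* p q k) (conv≗⊛ _ _ k)
        }
      ; 1#-homo = λ { zero → refl ; (suc _) → refl }
      }
    ; -‿homo = coeff-neg
    }
  ; injective = id
  }

polyRing : CommutativeRing 0ℓ 0ℓ
polyRing = record
  { isCommutativeRing = RingMonomorphism.isCommutativeRing coeff-isRingMonomorphism
      (CommutativeRing.isCommutativeRing ℤ[[y]].commutativeRing)
  }

module ℤ[y] = CommutativeRing polyRing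
module ℤ[y][[x]] = PowerSeries polyRing

*≋⊛ : ∀ f g → f * g ℤ[y][[x]].≋ f ℤ[y][[x]].⊛ g
*≋⊛ f g zero    = ℤ[y].+-identityʳ (f 0 Poly.* g 0)
-- `suc n ∸ suc i` reduces to `n ∸ i`, so the tail of the sum is definitionally the sum for
-- `f ∘ suc` and `g`.
*≋⊛ f g (suc n) = ℤ[y].+-cong {f 0 Poly.* g (suc n)} {f 0 Poly.* g (suc n)}
                  {((f ∘ suc) * g) n} {((f ∘ suc) ℤ[y][[x]].⊛ g) n}
                  (λ _ → refl) (*≋⊛ (f ∘ suc) g n)

const≋constant : ∀ p → const p ℤ[y][[x]].≋ ℤ[y][[x]].constant p
const≋constant p zero    _ = refl
const≋constant p (suc n) _ = refl

seriesRawRing : RawRing 0ℓ 0ℓ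
seriesRawRing = record
  { Carrier = Series
  ; _≈_ = _≈_ ; _+_ = _+_ ; _*_ = _*_ ; -_ = λ f n → Poly.- f n
  ; 0# = λ _ → [] ; 1# = # 1
  }

-- The two structures have the same carrier and equality, and differ only in how the product and the
-- unit are written; the ring laws transfer along the identity.
id-isRingMonomorphism :
  IsRingMonomorphism seriesRawRing (CommutativeRing.rawRing ℤ[y][[x]].commutativeRing) id
id-isRingMonomorphism = record
  { isRingHomomorphism = record
    { isSemiringHomomorphism = record
      { isNearSemiringHomomorphism = record
        { +-isMonoidHomomorphism = record
          { isMagmaHomomorphism = record
            { isRelHomomorphism = record { cong = id }
            ; homo = λ _ _ _ _ → refl
            }
          ; ε-homo = λ _ _ → refl
          }
        ; *-homo = *≋⊛
        }
      ; 1#-homo = const≋constant (Poly.const (+ 1))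
      }
    ; -‿homo = λ _ _ _ → refl
    }
  ; injective = id
  }

seriesRing : CommutativeRing 0ℓ 0ℓ
seriesRing = record
  { isCommutativeRing = RingMonomorphism.isCommutativeRing id-isRingMonomorphism
      (CommutativeRing.isCommutativeRing ℤ[y][[x]].commutativeRing)
  }

module S = CommutativeRing seriesRing

const-* : ∀ p f n → (const p * f) n Poly.≈ p Poly.* f n
const-* p f n k = trans (*≋⊛ (const p) f n k)
  (trans (ℤ[y][[x]].⊛-cong {const p} {ℤ[y][[x]].constant p} {f} {f} (const≋constant p) (λ _ _ → refl) n k)
         (ℤ[y][[x]].constant-⊛ p f n k))

integer : ℤ → Series
integer a = const (Poly.const a)

-- The solver's integer constants are interpreted by the same constant series as the numerals `# m`,
-- so solved identities are about the numerals of the theorem.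
integer-homo : CommutativeRing.rawRing ℤ.+-*-commutativeRing -Raw-AlmostCommutative⟶
               fromCommutativeRing seriesRing
integer-homo = record
  { ⟦_⟧    = integer
  ; +-homo = λ { a b zero k → refl ; a b (suc _) k → refl }
  ; *-homo = λ a b n k → trans (integer-* a b n k) (sym (const-* (Poly.const a) (integer b) n k))
  ; -‿homo = λ { a zero k → refl ; a (suc _) k → refl }
  ; 0-homo = λ { zero zero → refl ; zero (suc k) → refl ; (suc _) k → refl }
  ; 1-homo = λ _ _ → refl
  }
  where
  integer-* : ∀ a b n → integer (a ℤ.* b) n Poly.≈ Poly.const a Poly.* integer b n
  integer-* a b zero    zero    = sym (ℤ.+-identityʳ _)
  integer-* a b zero    (suc k) = refl
  integer-* a b (suc n) zero    = refl
  integer-* a b (suc n) (suc k) = refl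

-- Divisibility by powers of x

open Divisibility S.semiring using (_∣_) renaming (_,_ to _by_)
open Exp S.semiring using () renaming (_^_ to _^ˢ_)

x-shift : ∀ f n → (x * f) (suc n) Poly.≈ f n
x-shift f n k = trans (*≋⊛ x f (suc n) k)
  -- `x 0` is the empty list, so the first product vanishes definitionally; what is left has the
  -- factor `x ∘ suc`, the series one.
  (trans (ℤ[y][[x]].⊛-cong {x ∘ suc} {ℤ[y][[x]].constant (Poly.const (+ 1))} {f} {f}
           (λ { zero _ → refl ; (suc _) _ → refl }) (λ _ _ → refl) n k)
         (S′.*-identityˡ f n k))
  where module S′ = CommutativeRing ℤ[y][[x]].commutativeRing

q*x^n-low : ∀ q {n i} → i ℕ.< n → (q * x ^ˢ n) i Poly.≈ []
q*x^n-low q {suc n} {i} i<n k = trans (swap i k) (low i i<n k)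
  where
  swap : q * (x * x ^ˢ n) ≈ x * (q * x ^ˢ n)
  swap i k = trans (sym (S.*-assoc q x (x ^ˢ n) i k))
    (trans (S.*-congʳ {x ^ˢ n} {q * x} {x * q} (S.*-comm q x) i k) (S.*-assoc x q (x ^ˢ n) i k))

  low : ∀ i → i ℕ.< suc n → (x * (q * x ^ˢ n)) i Poly.≈ []
  low zero    _           _ = refl
  low (suc i) (ℕ.s≤s i<n) k = trans (x-shift (q * x ^ˢ n) i k) (q*x^n-low q i<n k)

x-separated : ∀ f → (∀ n → x ^ˢ n ∣ f) → f ≈ S.0#
-- Divisibility by the power i + 1 already kills the coefficient of index i.
x-separated f x^n∣f i k with x^n∣f (suc i)
... | q by eq = trans (sym (eq i k)) (q*x^n-low q (ℕ.n<1+n i) k)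

-- Weights of words and their first letters

-- Forbidden words get weight zero, so that sums range over all words. The guard is what
-- `does (avoids? _≥?_ _>?_ w)` reduces to, which lets `sum-filter` produce `weight` directly.
weight : Word → Poly
weight w = if not (does (contains? _≥?_ _>?_ w)) then Poly.y^ des w else []

-- An initial ascent is no descent and, failing ≥, starts no occurrence of the pattern.
weight-up : ∀ {a b} → a ℕ.< b → ∀ w → weight (a ∷ b ∷ w) ≡ weight (b ∷ w)
weight-up {a} {b} a<b []
  rewrite dec-false (b <? a) (ℕ.<-asym a<b) = refl
weight-up {a} {b} a<b (c ∷ w)
  rewrite dec-false (b <? a) (ℕ.<-asym a<b) | dec-false (b ≤? a) (ℕ.<⇒≱ a<b) = refl

-- The repeated letter satisfies ≥, so an occurrence starts here exactly when a > b; the next lemma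
-- is that other case.
weight-flat : ∀ {a b} → a ℕ.≤ b → ∀ w → weight (a ∷ a ∷ b ∷ w) ≡ weight (a ∷ b ∷ w)
weight-flat {a} {b} a≤b w
  rewrite dec-false (b <? a) (ℕ.≤⇒≯ a≤b) | dec-false (a <? a) (ℕ.n≮n a) | dec-true (a ≤? a) ℕ.≤-refl = refl

weight-flat-down : ∀ {a b} → b ℕ.< a → ∀ w → weight (a ∷ a ∷ b ∷ w) ≡ []
weight-flat-down {a} {b} b<a w
  rewrite dec-true (b <? a) b<a | dec-true (a ≤? a) ℕ.≤-refl = refl

y* : ∀ p → Poly.y^ 1 Poly.* p Poly.≈ + 0 ∷ p
y* p k = trans (coeff-+ (map (+ 0 ℤ.*_) p) _ k)
  (trans (cong₂ ℤ._+_ (trans (Coefficients.coeff-scale (+ 0) p k) (ℤ.*-zeroˡ (Poly.coeff p k))) refl)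
  (trans (ℤ.+-identityˡ _) (shifted k)))
  where
  shifted : + 0 ∷ Poly.const (+ 1) Poly.* p Poly.≈ + 0 ∷ p
  shifted zero    = refl
  shifted (suc k) = Coefficients.*-identityˡ p k

-- Both a > b and b = b satisfy ≥, so a descent to b and a repetition of b restrict the continuation
-- equally. Hence a descent can be replaced by a repetition at the cost of a factor y.
contains-down : ∀ {a b} → b ℕ.< a → ∀ w →
  does (contains? _≥?_ _>?_ (a ∷ b ∷ w)) ≡ does (contains? _≥?_ _>?_ (b ∷ b ∷ w))
contains-down         b<a []      = refl
contains-down {a} {b} b<a (c ∷ w)
  rewrite dec-true (b ≤? a) (ℕ.<⇒≤ b<a) | dec-true (b ≤? b) ℕ.≤-refl = refl

des-down : ∀ {a b} → b ℕ.< a → ∀ w → des (a ∷ b ∷ w) ≡ suc (des (b ∷ b ∷ w))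
des-down {a} {b} b<a w
  rewrite dec-true (b <? a) b<a | dec-false (b <? b) (ℕ.n≮n b) = refl

weight-down : ∀ {a b} → b ℕ.< a → ∀ w →
              weight (a ∷ b ∷ w) Poly.≈ Poly.y^ 1 Poly.* weight (b ∷ b ∷ w)
weight-down {a} {b} b<a w k =
  trans (cong₂ (λ r d → Poly.coeff (if not r then Poly.y^ d else []) k)
               (contains-down b<a w) (des-down b<a w))
        (guarded (does (contains? _≥?_ _>?_ (b ∷ b ∷ w))) (des (b ∷ b ∷ w)))
  where
  guarded : ∀ r d → Poly.coeff (if not r then Poly.y^ suc d else []) k ≡
                    Poly.coeff (Poly.y^ 1 Poly.* (if not r then Poly.y^ d else [])) k
  guarded false d = sym (y* (Poly.y^ d) k)
  guarded true  d = sym (ℤ[y].zeroʳ (Poly.y^ 1) k)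

-- Finite sums of polynomials

module _ {A : Set} where
  open ≡-Reasoning

  sum-++ : ∀ ps qs → Poly.sum (ps ++ qs) Poly.≈ Poly.sum ps Poly.+ Poly.sum qs
  sum-++ []       qs k = refl
  sum-++ (p ∷ ps) qs k = begin
    Poly.coeff (p Poly.+ Poly.sum (ps ++ qs)) k
      ≡⟨ coeff-+ p _ k ⟩
    Poly.coeff p k ℤ.+ Poly.coeff (Poly.sum (ps ++ qs)) k
      ≡⟨ cong₂ ℤ._+_ {Poly.coeff p k} refl (sum-++ ps qs k) ⟩
    Poly.coeff p k ℤ.+ Poly.coeff (Poly.sum ps Poly.+ Poly.sum qs) k
      ≡⟨ coeff-+ p _ k ⟨
    Poly.coeff (p Poly.+ (Poly.sum ps Poly.+ Poly.sum qs)) k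
      ≡⟨ ℤ[y].+-assoc p (Poly.sum ps) (Poly.sum qs) k ⟨
    Poly.coeff (p Poly.+ Poly.sum ps Poly.+ Poly.sum qs) k ∎

  sum-cong : ∀ {f g : A → Poly} → (∀ a → f a Poly.≈ g a) →
             ∀ as → Poly.sum (map f as) Poly.≈ Poly.sum (map g as)
  sum-cong         f≈g []       k = refl
  sum-cong {f} {g} f≈g (a ∷ as) k =
    ℤ[y].+-cong {f a} {g a} {Poly.sum (map f as)} {Poly.sum (map g as)} (f≈g a) (sum-cong f≈g as) k

  sum-scale : ∀ p (f : A → Poly) as →
              Poly.sum (map (λ a → p Poly.* f a) as) Poly.≈ p Poly.* Poly.sum (map f as)
  sum-scale p f []       k = sym (ℤ[y].zeroʳ p k)
  sum-scale p f (a ∷ as) k = begin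
    Poly.coeff (p Poly.* f a Poly.+ Poly.sum (map (λ a → p Poly.* f a) as)) k
      ≡⟨ ℤ[y].+-congˡ {p Poly.* f a} {Poly.sum (map (λ a → p Poly.* f a) as)}
           {p Poly.* Poly.sum (map f as)} (sum-scale p f as) k ⟩
    Poly.coeff (p Poly.* f a Poly.+ p Poly.* Poly.sum (map f as)) k
      ≡⟨ ℤ[y].distribˡ p (f a) (Poly.sum (map f as)) k ⟨
    Poly.coeff (p Poly.* (f a Poly.+ Poly.sum (map f as))) k ∎

  sum-concatMap : ∀ {B : Set} (g : B → Poly) (h : A → List B) as →
                  Poly.sum (map g (concatMap h as)) Poly.≈ Poly.sum (map (λ a → Poly.sum (map g (h a))) as)
  sum-concatMap g h []       k = refl
  sum-concatMap g h (a ∷ as) k = begin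
    Poly.coeff (Poly.sum (map g (h a ++ concatMap h as))) k
      ≡⟨ cong (λ ps → Poly.coeff (Poly.sum ps) k) (map-++ g (h a) (concatMap h as)) ⟩
    Poly.coeff (Poly.sum (map g (h a) ++ map g (concatMap h as))) k
      ≡⟨ sum-++ (map g (h a)) _ k ⟩
    Poly.coeff (Poly.sum (map g (h a)) Poly.+ Poly.sum (map g (concatMap h as))) k
      ≡⟨ ℤ[y].+-congˡ {Poly.sum (map g (h a))} {Poly.sum (map g (concatMap h as))}
           {Poly.sum (map (λ a → Poly.sum (map g (h a))) as)} (sum-concatMap g h as) k ⟩
    Poly.coeff (Poly.sum (map g (h a)) Poly.+ Poly.sum (map (λ a → Poly.sum (map g (h a))) as)) k ∎

  sum-filter : ∀ {P : Pred A 0ℓ} (P? : Decidable P) (f : A → Poly) as →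
               Poly.sum (map f (filter P? as)) Poly.≈
               Poly.sum (map (λ a → if does (P? a) then f a else []) as)
  sum-filter P? f []       k = refl
  sum-filter P? f (a ∷ as) k with does (P? a)
  ... | true  = ℤ[y].+-congˡ {f a} {Poly.sum (map f (filter P? as))}
                  {Poly.sum (map (λ a → if does (P? a) then f a else []) as)} (sum-filter P? f as) k
  ... | false = sum-filter P? f as k

-- Recursions for the series of continuations

total : (Word → Poly) → ℕ → ℕ → Poly
total g k n = Poly.sum (map g (wordsFrom k n))

total-suc : ∀ g k n → total g k (suc n) Poly.≈ ∑ (λ b → total (λ w → g (b ∷ w)) (suc b) n) (suc k)
total-suc g k n i = begin
  Poly.coeff (total g k (suc n)) i
    ≡⟨ sum-concatMap g (λ a → map (a ∷_) (wordsFrom (suc a) n)) (upTo (suc k)) i ⟩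
  Poly.coeff (Poly.sum (map (λ b → Poly.sum (map g (map (b ∷_) (wordsFrom (suc b) n)))) (upTo (suc k)))) i
    ≡⟨ cong (λ ps → Poly.coeff (Poly.sum ps) i)
         (map-cong {g = λ b → total (λ w → g (b ∷ w)) (suc b) n}
           (λ b → cong Poly.sum (sym (map-∘ (wordsFrom (suc b) n)))) (upTo (suc k))) ⟩
  Poly.coeff (Poly.sum (map (λ b → total (λ w → g (b ∷ w)) (suc b) n) (upTo (suc k)))) i
    ≡⟨ cong (λ ps → Poly.coeff (Poly.sum ps) i) (map-upTo (λ b → total (λ w → g (b ∷ w)) (suc b) n) (suc k)) ⟩
  Poly.coeff (∑ (λ b → total (λ w → g (b ∷ w)) (suc b) n) (suc k)) i ∎
  where open ≡-Reasoning

-- The next letter is at most suc a.  Prefixing a (for U) or a a (for L)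
-- records whether the letter a was reached by an ascent.
U L : ℕ → Series
U a n = total (λ w → weight (a ∷ w)) (suc a) n
L a n = total (λ w → weight (a ∷ a ∷ w)) (suc a) n

-- The factor x is encoded as the shift of the index, whence the zero coefficient at length 0.
D : ℕ → Series
D a zero    = []
D a (suc n) = ∑ (λ b → Poly.y^ 1 Poly.* L b n) a

D-zero : D 0 ≈ S.0#
D-zero zero    k = refl
D-zero (suc n) k = refl

D-suc : ∀ a → D (suc a) ≈ D a + y * (x * L a)
D-suc a n k = trans (split n)
  (trans (cong (λ z → Poly.coeff (D a n) k ℤ.+ z) (sym (const-* (Poly.y^ 1) (x * L a) n k)))
         (sym (coeff-+ (D a n) _ k)))
  where
  split : ∀ n → Poly.coeff (D (suc a) n) k ≡
                Poly.coeff (D a n) k ℤ.+ Poly.coeff (Poly.y^ 1 Poly.* (x * L a) n) k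
  split zero    = trans (sym (ℤ[y].zeroʳ (Poly.y^ 1) k)) (sym (ℤ.+-identityˡ _))
  split (suc n) = trans (∑-last (λ b → Poly.y^ 1 Poly.* L b n) a k)
    (cong (λ z → Poly.coeff (D a (suc n)) k ℤ.+ z)
      (sym (ℤ[y].*-congˡ {Poly.y^ 1} {(x * L a) (suc n)} {L a n} (x-shift (L a) n) k)))

-- After the letter a the next letter descends, repeats a or rises to a + 1; the three summands are
-- these cases, each with its own weight lemma.
total-suc-suc : ∀ g a n k → Poly.coeff (total g (suc a) (suc n)) k ≡
  Poly.coeff (∑ (λ b → total (λ w → g (b ∷ w)) (suc b) n) a) k
    ℤ.+ Poly.coeff (total (λ w → g (a ∷ w)) (suc a) n) k
    ℤ.+ Poly.coeff (total (λ w → g (suc a ∷ w)) (suc (suc a)) n) k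
total-suc-suc g a n k = trans (total-suc g (suc a) n k) (trans (∑-last T (suc a) k)
  (cong (λ z → z ℤ.+ Poly.coeff (T (suc a)) k) (∑-last T a k)))
  where T = λ b → total (λ w → g (b ∷ w)) (suc b) n

total-cong : ∀ {g h} → g ≗ h → ∀ k n → total g k n ≡ total h k n
total-cong g≗h k n = cong Poly.sum (map-cong g≗h (wordsFrom k n))

≡⇒≈ : ∀ {p q} → p ≡ q → p Poly.≈ q
≡⇒≈ refl _ = refl

-- Descents contribute `D a` by `weight-down`, the repetition is `L a` by definition, and the ascent
-- gives `U (suc a)` by `weight-up`.
U-suc : ∀ a n k → Poly.coeff (U a (suc n)) k ≡
  Poly.coeff (D a (suc n)) k ℤ.+ Poly.coeff (L a n) k ℤ.+ Poly.coeff (U (suc a) n) k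
U-suc a n k = trans (total-suc-suc (λ w → weight (a ∷ w)) a n k)
  (cong₂ (λ u v → u ℤ.+ Poly.coeff (L a n) k ℤ.+ v)
    (∑-cong (λ b → total (λ w → weight (a ∷ b ∷ w)) (suc b) n) (λ b → Poly.y^ 1 Poly.* L b n) a
      (λ {b} b<a i → trans (sum-cong (weight-down b<a) (wordsFrom (suc b) n) i)
         (sum-scale (Poly.y^ 1) (λ w → weight (b ∷ b ∷ w)) (wordsFrom (suc b) n) i)) k)
    (≡⇒≈ (total-cong (weight-up (ℕ.n<1+n a)) (suc (suc a)) n) k))

sum-zero : ∀ {A : Set} (as : List A) → Poly.sum (map (λ _ → []) as) Poly.≈ []
sum-zero []       k = refl
sum-zero (_ ∷ as) k = sum-zero as k

∑-zero : ∀ n → ∑ (λ _ → []) n Poly.≈ []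
∑-zero zero    k = refl
∑-zero (suc n) k = ∑-zero n k

-- As for `U-suc`, except that a descent after a repetition completes the pattern, so the sum over b
-- < a vanishes.
L-suc : ∀ a n k → Poly.coeff (L a (suc n)) k ≡
  Poly.coeff (L a n) k ℤ.+ Poly.coeff (U (suc a) n) k
L-suc a n k = trans (total-suc-suc (λ w → weight (a ∷ a ∷ w)) a n k)
  (cong₂ ℤ._+_
    (trans (cong₂ ℤ._+_
             (trans (∑-cong (λ b → total (λ w → weight (a ∷ a ∷ b ∷ w)) (suc b) n) (λ _ → []) a
                      (λ {b} b<a i → trans (≡⇒≈ (total-cong (weight-flat-down b<a) (suc b) n) i)
                                           (sum-zero (wordsFrom (suc b) n) i)) k)
                    (∑-zero a k))
             (≡⇒≈ (total-cong (weight-flat {a} ℕ.≤-refl) (suc a) n) k))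
           (ℤ.+-identityˡ (Poly.coeff (L a n) k)))
    (≡⇒≈ (total-cong (λ w → trans (weight-flat (ℕ.n≤1+n a) w) (weight-up (ℕ.n<1+n a) w))
                     (suc (suc a)) n) k))

L-zero : ∀ a → L a 0 ≡ Poly.const (+ 1)
L-zero a rewrite dec-false (a <? a) (ℕ.n≮n a) = refl

U≈L+D : ∀ a → U a ≈ L a + D a
U≈L+D a zero    k = sym (trans (ℤ[y].+-identityʳ (L a 0) k) (≡⇒≈ (L-zero a) k))
U≈L+D a (suc n) k = begin
  Poly.coeff (U a (suc n)) k
    ≡⟨ U-suc a n k ⟩
  d ℤ.+ l ℤ.+ u
    ≡⟨ ℤ.+-assoc d l u ⟩
  d ℤ.+ (l ℤ.+ u)
    ≡⟨ ℤ.+-comm d (l ℤ.+ u) ⟩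
  l ℤ.+ u ℤ.+ d
    ≡⟨ cong (λ z → z ℤ.+ d) (L-suc a n k) ⟨
  Poly.coeff (L a (suc n)) k ℤ.+ d
    ≡⟨ coeff-+ (L a (suc n)) _ k ⟨
  Poly.coeff ((L a + D a) (suc n)) k ∎
  where
  open ≡-Reasoning
  d = Poly.coeff (D a (suc n)) k
  l = Poly.coeff (L a n) k
  u = Poly.coeff (U (suc a) n) k

L-step : ∀ a → L a ≈ # 1 + x * (L a + (L (suc a) + D (suc a)))
L-step a zero    k = ≡⇒≈ (L-zero a) k
L-step a (suc n) k = begin
  Poly.coeff (L a (suc n)) k
    ≡⟨ L-suc a n k ⟩
  Poly.coeff (L a n) k ℤ.+ Poly.coeff (U (suc a) n) k
    ≡⟨ cong (λ z → Poly.coeff (L a n) k ℤ.+ z) (U≈L+D (suc a) n k) ⟩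
  Poly.coeff (L a n) k ℤ.+ Poly.coeff ((L (suc a) + D (suc a)) n) k
    ≡⟨ coeff-+ (L a n) _ k ⟨
  Poly.coeff ((L a + (L (suc a) + D (suc a))) n) k
    ≡⟨ x-shift (L a + (L (suc a) + D (suc a))) n k ⟨
  Poly.coeff ((# 1 + x * (L a + (L (suc a) + D (suc a)))) (suc n)) k ∎
  where open ≡-Reasoning

-- The generating function and its closed form

-- A nonempty word starts with 0, which is unconstrained like a letter reached by an ascent and
-- gives `U 0`; no letter lies below 0, so `U 0` agrees with `L 0`.
C≈1+xL₀ : C _≥?_ _>?_ ≈ # 1 + x * L 0
C≈1+xL₀ zero    k = refl
C≈1+xL₀ (suc n) k = begin
  Poly.coeff (C _≥?_ _>?_ (suc n)) k
    ≡⟨ sum-filter (avoids? _≥?_ _>?_) (λ w → Poly.y^ des w) (catalanWords (suc n)) k ⟩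
  Poly.coeff (total weight 0 (suc n)) k
    ≡⟨ total-suc weight 0 n k ⟩
  Poly.coeff (U 0 n Poly.+ []) k
    ≡⟨ ℤ[y].+-identityʳ (U 0 n) k ⟩
  Poly.coeff (U 0 n) k
    ≡⟨ U≈L+D 0 n k ⟩
  Poly.coeff ((L 0 + D 0) n) k
    ≡⟨ coeff-+ (L 0 n) _ k ⟩
  Poly.coeff (L 0 n) k ℤ.+ Poly.coeff (D 0 n) k
    ≡⟨ cong (λ z → Poly.coeff (L 0 n) k ℤ.+ z) (D-zero n k) ⟩
  Poly.coeff (L 0 n) k ℤ.+ + 0
    ≡⟨ ℤ.+-identityʳ _ ⟩
  Poly.coeff (L 0 n) k
    ≡⟨ x-shift (L 0) n k ⟨
  Poly.coeff ((# 1 + x * L 0) (suc n)) k ∎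
  where
  open ≡-Reasoning

private
  module Transfer = TransferSystem seriesRing integer-homo

C-root : Transfer.quadratic x y (C _≥?_ _>?_) ≈ S.0#
C-root = Transfer.quadratic-root x y x-separated L D D-zero D-suc L-step C≈1+xL₀

theorem3p16 : ∃[ √S ]
    ( IsSqrt (# 1 - # 4 * x + # 4 * x ^ 2 - # 2 * x ^ 2 * y + x ^ 4 * y ^ 2) √S
    × # 2 * x ^ 2 * y * C _≥?_ _>?_ ≈ # 1 - # 2 * x + x ^ 2 * y - √S )
theorem3p16 = √S
  -- The constant coefficient evaluates to the list 1, 0; the cases run past its trailing zero.
  , ((λ { zero → refl ; (suc zero) → refl ; (suc (suc k)) → refl })
    , Transfer.quadratic-discriminant x y (C _≥?_ _>?_) C-root)
  , Transfer.subtrahend-recovery (# 1 - # 2 * x + x ^ 2 * y) (# 2 * x ^ 2 * y * C _≥?_ _>?_)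
  where
  -- The root is obtained by solving the second equation for it, which avoids dividing by 2 x² y.
  √S = # 1 - # 2 * x + x ^ 2 * y - # 2 * x ^ 2 * y * C _≥?_ _>?_
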